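{- Let $G$ be an $n$-vertex directed graph with transversal number $\tau$. There is a word of length $O(\tau^2 n)$ that fixes every $n$-component monotone network with an interaction graph isomorphic to a subgraph of $G$.
   Context: The constant implied in $O(\cdot)$ is absolute (independent of $n$, $\tau$ and $G$). Graphs are directed and may contain loops. The transversal number of a directed graph is the minimum number of vertices to delete to make it acyclic (a loop is a cycle of length one). Write $[n]=\{1,\dots,n\}$. An $n$-component (Boolean) network is a function $f=(f_1,\dots,f_n):\{0,1\}^n\to\{0,1\}^n$. The interaction graph of $f$ is the directed graph on $[n]$ with an edge from $j$ to $i$ iff $f_i$ depends on $x_j$, i.e. there exist $x,y\in\{0,1\}^n$ differing only in component $j$ with $f_i(x)\ne f_i(y)$. For $i\in[n]$ and $x\in\{0,1\}^n$, $f^i(x):=(x_1,\dots,x_{i-1},f_i(x),x_{i+1},\dots,x_n)$. For a word $w=i_1i_2\dots i_k$ over the alphabet $[n]$, $f^w:=f^{i_k}\circ\cdots\circ f^{i_1}$ (and $f^\epsilon=\mathrm{id}$ for the empty word $\epsilon$). A word $w$ over $[n]$ fixes $f$ if $f^w(x)$ is a fixed point of $f$ for every $x\in\{0,1\}^n$. The network $f$ is monotone if $x\le y$ (componentwise) implies $f(x)\le f(y)$.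
   Formalization: The word is over the vertices of G and is read through the isomorphism placing the interaction graph in G (one word for all labellings is impossible, e.g. for a path with a loop); the bound is O(max(1,τ)² n), since for τ = 0 the empty word does not suffice. -}

module Defs where

open import Data.Bool.Base using (Bool) renaming (_≤_ to _≤ᵇ_)
import Data.Bool.Properties as Bool
open import Data.Fin.Base using (Fin)
open import Data.Fin.Permutation using (Permutation′; _⟨$⟩ʳ_; _⟨$⟩ˡ_)
open import Data.Fin.Properties using (all?) renaming (_≟_ to _≟ᶠ_)
open import Data.Fin.Subset using (Subset; _∉_; ∣_∣)
open import Data.Fin.Subset.Properties using (anySubset?; _∈?_)
open import Data.List.Base using (List; []; _∷_; _∷ʳ_; map)
open import Data.List.Relation.Unary.Linked using (Linked)
open import Data.List.Relation.Unary.Unique.Propositional using (Unique)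
open import Data.Nat.Base using (ℕ; _≤_; _⊔_; _^_; _*_)
open import Data.Product.Base using (∃-syntax; _×_)
open import Data.Vec.Base using (Vec; lookup; _[_]≔_)
open import Data.Vec.Relation.Binary.Pointwise.Inductive using (Pointwise)
open import Function.Bundles using (_⇔_)
open import Level using (0ℓ)
open import Relation.Binary.Core using (Rel)
open import Relation.Binary.Definitions using (Decidable)
open import Relation.Binary.PropositionalEquality using (_≡_; _≢_)
open import Relation.Nullary using (¬_)
open import Relation.Nullary.Decidable using (_×-dec_; _→-dec_; ¬?)

-- Adjacency in a finite graph is decidable; a constructive treatment has to
-- carry this as data.

record Digraph (n : ℕ) : Set₁ where
  field
    Edge  : Rel (Fin n) 0ℓ
    edge? : Decidable Edge

open Digraph public

-- On a common vertex set, so these are spanning subgraphs.  A graph with n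
-- vertices that is isomorphic to a subgraph of an n-vertex graph can only be
-- isomorphic to a spanning one.

infix 4 _⊑_

_⊑_ : ∀ {n} → Digraph n → Digraph n → Set
H ⊑ G = ∀ j i → Edge H j i → Edge G j i

IsIsomorphism : ∀ {n} → Digraph n → Digraph n → Permutation′ n → Set
IsIsomorphism H K π = ∀ j i → Edge H j i ⇔ Edge K (π ⟨$⟩ʳ j) (π ⟨$⟩ʳ i)

-- The cycle v → v₁ → … → vₖ → v is given by its distinct vertices v , v₁ … vₖ;
-- for k = 0 it is a loop.

IsCycle : ∀ {n} → Digraph n → Fin n → List (Fin n) → Set
IsCycle G v vs = Unique (v ∷ vs) × Linked (Edge G) (v ∷ (vs ∷ʳ v))

Acyclic : ∀ {n} → Digraph n → Set
Acyclic G = ∀ v vs → ¬ IsCycle G v vs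

-- Deleted vertices are kept as isolated, loopless vertices, which lie on no
-- cycle.

infixl 6 _∖_

_∖_ : ∀ {n} → Digraph n → Subset n → Digraph n
(G ∖ S) .Edge  j i = j ∉ S × i ∉ S × Edge G j i
(G ∖ S) .edge? j i = ¬? (j ∈? S) ×-dec ¬? (i ∈? S) ×-dec edge? G j i

IsTransversalNumber : ∀ {n} → Digraph n → ℕ → Set
IsTransversalNumber G τ =
  (∃[ S ] ∣ S ∣ ≡ τ × Acyclic (G ∖ S)) ×
  (∀ S → Acyclic (G ∖ S) → τ ≤ ∣ S ∣)

State : ℕ → Set
State n = Vec Bool n

Network : ℕ → Set
Network n = State n → State n

Monotone : ∀ {n} → Network n → Set
Monotone f = ∀ {x y} → Pointwise _≤ᵇ_ x y → Pointwise _≤ᵇ_ (f x) (f y)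

DifferOnlyAt : ∀ {n} → Fin n → State n → State n → Set
DifferOnlyAt j x y =
  lookup x j ≢ lookup y j × (∀ k → k ≢ j → lookup x k ≡ lookup y k)

differOnlyAt? : ∀ {n} (j : Fin n) → Decidable (DifferOnlyAt j)
differOnlyAt? j x y =
  ¬? (lookup x j Bool.≟ lookup y j) ×-dec
  all? (λ k → ¬? (k ≟ᶠ j) →-dec (lookup x k Bool.≟ lookup y k))

DependsOn : ∀ {n} → Network n → Fin n → Fin n → Set
DependsOn f i j =
  ∃[ x ] ∃[ y ] DifferOnlyAt j x y × lookup (f x) i ≢ lookup (f y) i

-- States of n components are definitionally subsets of Fin n.

dependsOn? : ∀ {n} (f : Network n) → Decidable (DependsOn f)
dependsOn? f i j =
  anySubset? λ x → anySubset? λ y →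
    differOnlyAt? j x y ×-dec ¬? (lookup (f x) i Bool.≟ lookup (f y) i)

interactionGraph : ∀ {n} → Network n → Digraph n
interactionGraph f .Edge  j i = DependsOn f i j
interactionGraph f .edge? j i = dependsOn? f i j

Word : ℕ → Set
Word n = List (Fin n)

update : ∀ {n} → Network n → Fin n → State n → State n
update f i x = x [ i ]≔ lookup (f x) i

run : ∀ {n} → Network n → Word n → State n → State n
run f []      x = x
run f (i ∷ w) x = run f w (update f i x)

Fixes : ∀ {n} → Word n → Network n → Set
Fixes w f = ∀ x → f (run f w x) ≡ run f w x

-- A word over the vertices of G, read as a word over the components of a
-- network whose interaction graph is placed in G by π.  The placement has to
-- be used: no single word of length O(n), read identically for all placements,
-- can work when G is a directed path with one loop (transversal number 1),
-- because it would have to contain every permutation of the n vertices as a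
-- subsequence.

pullback : ∀ {n} → Permutation′ n → Word n → Word n
pullback π = map (π ⟨$⟩ˡ_)

-- For 1 ≤ τ this is τ ^ 2 * n.  A nonempty acyclic graph has τ = 0, and a
-- constant network already shows that the empty word does not suffice, so the
-- order τ ^ 2 * n is read there as n.

order : ℕ → ℕ → ℕ
order τ n = (1 ⊔ τ) ^ 2 * n

{-# OPTIONS --safe #-}

-- Let S be a transversal and u a topological order of the other vertices.
-- Running u makes every component outside S stable, and the vertices of S are
-- then included one at a time.  If all components of T are stable in x, then
-- updating a further component s to the value b = fₛ(x) gives a state from
-- which, by monotonicity, components of T ∪ {s} can only change towards b.
-- During a round u S' (S' the part of S included so far) either a component of
-- S' changes, which happens at most once to each, or the state reached after u
-- is already stable on T ∪ {s}.  So O(τ) rounds of length O(n) suffice for each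
-- of the τ vertices of S.
module Submission where

open import Defs
open import Data.Bool.Base using (Bool; true; false; b≤b; f≤t) renaming (_≤_ to _≤ᵇ_)
import Data.Bool.Properties as Bool
open import Data.Fin.Base using (Fin; zero; suc)
open import Data.Fin.Permutation
  using (Permutation′; _⟨$⟩ʳ_; _⟨$⟩ˡ_; inverseˡ; inverseʳ)
open import Data.Fin.Properties using () renaming (_≟_ to _≟ᶠ_)
open import Data.Fin.Subset
  using (Subset; inside; outside; ∣_∣; _∉_) renaming (_∈_ to _∈ˢ_)
open import Data.Fin.Subset.Properties using (∣p∣≤n) renaming (_∈?_ to _∈ˢ?_)
open import Data.List.Base
  using (List; []; _∷_; _∷ʳ_; _++_; allFin; concat; filter; length; map; replicate)
open import Data.List.Membership.DecPropositional using () renaming (_∈?_ to member?)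
open import Data.List.Membership.Propositional using (_∈_; find; lose)
open import Data.List.Membership.Propositional.Properties
  using (∈-++⁺ˡ; ∈-++⁺ʳ; ∈-++⁻; ∈-allFin; ∈-filter⁺; ∈-filter⁻; ∈-map⁺)
open import Data.List.Properties
  using (concat-map; filter-notAll; length-++; length-filter; length-map;
         length-tabulate; map-++; map-replicate)
open import Data.List.Relation.Binary.Subset.Propositional using (_⊆_)
open import Data.List.Relation.Binary.Subset.Propositional.Properties using (All-resp-⊇)
open import Data.List.Relation.Unary.All as All using (All; []; _∷_)
open import Data.List.Relation.Unary.AllPairs as AllPairs using (AllPairs; []; _∷_)
open import Data.List.Relation.Unary.All.Properties using (¬Any⇒All¬)
import Data.List.Relation.Unary.All.Properties as All
import Data.List.Relation.Unary.AllPairs.Properties as AllPairs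
open import Data.List.Relation.Unary.Any as Any using (any?; here; there)
open import Data.List.Relation.Unary.Linked using (Linked; [-]; _∷_)
open import Data.List.Relation.Unary.Unique.Propositional using (Unique)
open import Data.Nat.Base
  using (ℕ; zero; suc; _+_; _*_; _^_; _≤_; _<_; _⊔_; z≤n; s≤s; s≤s⁻¹)
open import Data.Nat.Properties
open import Data.Nat.Tactic.RingSolver using (solve-∀)
open import Data.Product.Base using (∃-syntax; _×_; _,_; proj₁; proj₂)
open import Data.Sum.Base using (inj₁; inj₂; [_,_]′)
open import Data.Vec.Base using ([]; _∷_; lookup; _[_]≔_; here; there)
open import Data.Vec.Properties using (lookup∘update; lookup∘update′; []≔-lookup)
open import Data.Vec.Relation.Binary.Pointwise.Extensional
  using (ext; extensional⇒inductive)
open import Data.Vec.Relation.Binary.Pointwise.Inductive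
  using (Pointwise-≡⇒≡) renaming (lookup to app)
open import Function.Base using (_∘_; id)
open import Function.Bundles using (Equivalence)
open import Relation.Binary.PropositionalEquality
  using (_≡_; _≢_; refl; sym; trans; cong; cong₂; subst; subst₂; module ≡-Reasoning)
open import Relation.Nullary using (¬_; yes; no; contradiction)
open import Relation.Nullary.Decidable using (¬?)

private
  variable
    n : ℕ

-- Finite subsets as lists

erase : Fin n → List (Fin n) → List (Fin n)
erase i = filter (λ j → ¬? (j ≟ᶠ i))

length-erase : ∀ {i : Fin n} {is} → i ∈ is → length (erase i is) < length is
length-erase i∈is =
  filter-notAll _ _ (Any.map (λ i≡j j≢i → j≢i (sym i≡j)) i∈is)

∈-erase⁺ : ∀ {i j : Fin n} {is} → j ∈ is → j ≢ i → j ∈ erase i is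
∈-erase⁺ = ∈-filter⁺ _

erase⊆ : ∀ (i : Fin n) is → erase i is ⊆ is
erase⊆ i is = proj₁ ∘ ∈-filter⁻ _ {xs = is}

elements : Subset n → List (Fin n)
elements []            = []
elements (inside  ∷ S) = zero ∷ map suc (elements S)
elements (outside ∷ S) = map suc (elements S)

∈-elements : ∀ (S : Subset n) {i} → i ∈ˢ S → i ∈ elements S
∈-elements (inside  ∷ S) here        = here refl
∈-elements (inside  ∷ S) (there i∈S) = there (∈-map⁺ suc (∈-elements S i∈S))
∈-elements (outside ∷ S) (there i∈S) = ∈-map⁺ suc (∈-elements S i∈S)

length-elements : ∀ (S : Subset n) → length (elements S) ≡ ∣ S ∣
length-elements []            = refl
length-elements (inside  ∷ S) =
  cong suc (trans (length-map suc (elements S)) (length-elements S))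
length-elements (outside ∷ S) = trans (length-map suc (elements S)) (length-elements S)

-- Topological sorting

module _ (G : Digraph n) (acyclic : Acyclic G) where

  -- Cut the path just before `q`; when `v` is `q`, the result is a cycle. The start `v` is separate
  -- from `q` because it moves along the path in the recursion, and `vs ⊆ xs` carries distinctness
  -- through it.
  close-walk : ∀ {q v xs} → Unique xs → q ∈ xs → Linked (Edge G) (v ∷ xs) →
               ∃[ vs ] vs ⊆ xs × Unique (q ∷ vs) × Linked (Edge G) (v ∷ (vs ∷ʳ q))
  close-walk _ (here refl) (e ∷ _) = [] , (λ ()) , [] ∷ [] , e ∷ [-]
  close-walk (x∉xs ∷ xs!) (there q∈xs) (e ∷ es)
    with vs , vs⊆xs , q∉vs ∷ vs! , es′ ← close-walk xs! q∈xs es =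
    _ ∷ vs ,
    (λ { (here eq) → here eq ; (there j∈vs) → there (vs⊆xs j∈vs) }) ,
    ((λ q≡x → All.lookup x∉xs q∈xs (sym q≡x)) ∷ q∉vs) ∷
      (All-resp-⊇ vs⊆xs x∉xs ∷ vs!) ,
    e ∷ es′

  module _ {R : List (Fin n)}
           (predecessor : ∀ {i} → i ∈ R → ∃[ j ] j ∈ R × Edge G j i) where

    -- Such a path could be prolonged backwards forever: a predecessor on the path closes a cycle,
    -- and a new one uses up an element of `rs`, which contains the vertices of `R` off the path.
    -- The recursion is on the bound `m`.
    no-backward-walk : ∀ m rs {p ps} → length rs < m →
      (∀ {j} → j ∈ R → ¬ j ∈ p ∷ ps → j ∈ rs) →
      p ∈ R → Unique (p ∷ ps) → ¬ Linked (Edge G) (p ∷ ps)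
    no-backward-walk (suc m) rs {p} {ps} rs<m unvisited p∈R ps! es
      with q , q∈R , e ← predecessor p∈R
      with member? _≟ᶠ_ q (p ∷ ps)
    ... | yes q∈ps =
      let vs , _ , vs! , es′ = close-walk ps! q∈ps (e ∷ es) in
      acyclic q vs (vs! , es′)
    ... | no q∉ps =
      no-backward-walk m (erase q rs)
        (<-≤-trans (length-erase (unvisited q∈R q∉ps)) (s≤s⁻¹ rs<m))
        (λ j∈R j∉ → ∈-erase⁺ (unvisited j∈R (j∉ ∘ there)) (j∉ ∘ here))
        q∈R (¬Any⇒All¬ _ q∉ps ∷ ps!) (e ∷ es)

  -- Otherwise every vertex of `R` has a predecessor in `R`, and the one-vertex path at `r`
  -- contradicts `no-backward-walk`.
  source : ∀ {r} {R : List (Fin n)} → r ∈ R →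
           ∃[ v ] v ∈ R × All (λ j → ¬ Edge G j v) R
  source {R = R} r∈R with any? (λ v → All.all? (λ j → ¬? (edge? G j v)) R) R
  ... | yes v-source = find v-source
  ... | no no-source =
    contradiction [-]
      (no-backward-walk predecessor (suc (length R)) R ≤-refl
        (λ j∈R _ → j∈R) r∈R ([] ∷ []))
    where
    predecessor : ∀ {i} → i ∈ R → ∃[ j ] j ∈ R × Edge G j i
    predecessor {i} i∈R with any? (λ j → edge? G j i) R
    ... | yes e = find e
    ... | no ¬e = contradiction (lose i∈R (¬Any⇒All¬ R ¬e)) no-source

  -- A source of `R` can come first, since no later vertex has an edge to it. The bound `m` is fuel,
  -- as `erase v R` is not structurally smaller than `R`.
  topological-sort : ∀ m (R : List (Fin n)) → length R ≤ m →
    ∃[ u ] AllPairs (λ i j → ¬ Edge G j i) u × u ⊆ R × R ⊆ u × length u ≤ length R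
  topological-sort _ [] _ = [] , [] , id , id , z≤n
  topological-sort (suc m) R@(_ ∷ _) R≤m =
    let v , v∈R , v-source = source (here refl)
        shrink = length-erase v∈R
        u , sorted , u⊆ , ⊆u , u≤ =
          topological-sort m (erase v R) (s≤s⁻¹ (<-≤-trans shrink R≤m))
        u⊆R = λ {j} → erase⊆ v R {j} ∘ u⊆
    in
    v ∷ u ,
    All-resp-⊇ u⊆R v-source ∷ sorted ,
    (λ { (here refl) → v∈R ; (there j∈u) → u⊆R j∈u }) ,
    (λ {j} j∈R → case-≟ j v (λ { refl → here refl })
                            (λ j≢v → there (⊆u (∈-erase⁺ j∈R j≢v)))) ,
    ≤-<-trans u≤ shrink
    where
    case-≟ : ∀ {A : Set} (i j : Fin n) → (i ≡ j → A) → (i ≢ j → A) → A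
    case-≟ i j y z with i ≟ᶠ j
    ... | yes i≡j = y i≡j
    ... | no  i≢j = z i≢j

fixingWord : {A : Set} → List A → List A → List A
fixingWord u []       = u
fixingWord u (s ∷ ss) =
  -- The tail is included before `s`, and the lone `s` sets the direction of change. There is one
  -- round for each element of `s ∷ ss` that may change, and a last one in which none does.
  fixingWord u ss ++ s ∷ concat (replicate (2 + length ss) (u ++ s ∷ ss))

-- Lets the pulled back word be analysed as a fixing word over the components of the network.
map-fixingWord : ∀ {A B : Set} (g : A → B) u ss →
                 map g (fixingWord u ss) ≡ fixingWord (map g u) (map g ss)
map-fixingWord g u [] = refl
map-fixingWord g u (s ∷ ss) = begin
  map g (fixingWord u ss ++ s ∷ concat (replicate m T))
    ≡⟨ map-++ g (fixingWord u ss) _ ⟩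
  map g (fixingWord u ss) ++ g s ∷ map g (concat (replicate m T))
    ≡⟨ cong₂ (λ v w → v ++ g s ∷ w) (map-fixingWord g u ss) rounds ⟩
  fixingWord (map g u) (map g ss) ++ g s ∷ concat (replicate m′ T′) ∎
  where
  open ≡-Reasoning
  m  = 2 + length ss
  m′ = 2 + length (map g ss)
  T  = u ++ s ∷ ss
  T′ = map g u ++ map g (s ∷ ss)
  rounds : map g (concat (replicate m T)) ≡ concat (replicate m′ T′)
  rounds = begin
    map g (concat (replicate m T))       ≡⟨ concat-map (replicate m T) ⟨
    concat (map (map g) (replicate m T)) ≡⟨ cong concat (map-replicate (map g) m T) ⟩
    concat (replicate m (map g T))
      ≡⟨ cong₂ (λ k t → concat (replicate k t))
               (cong (2 +_) (sym (length-map g ss))) (map-++ g u (s ∷ ss)) ⟩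
    concat (replicate m′ T′)             ∎

length-concat-replicate : ∀ {A : Set} m (xs : List A) →
                          length (concat (replicate m xs)) ≡ m * length xs
length-concat-replicate zero    xs = refl
length-concat-replicate (suc m) xs =
  trans (length-++ xs) (cong (length xs +_) (length-concat-replicate m xs))

-- Each of the `t` inclusions is charged the cost of the last and longest one: a single letter and
-- `1 + t` rounds of length `p + t`.
length-fixingWord : ∀ {A : Set} (u ss : List A) →
  let p = length u ; t = length ss in
  length (fixingWord u ss) ≤ p + t * (1 + (1 + t) * (p + t))
length-fixingWord u [] = m≤m+n (length u) 0
length-fixingWord u (s ∷ ss) = begin
  length (fixingWord u ss ++ s ∷ rounds)
    ≡⟨ length-++ (fixingWord u ss) ⟩
  length (fixingWord u ss) + suc (length rounds)
    ≡⟨ cong (λ k → length (fixingWord u ss) + suc k)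
            (trans (length-concat-replicate (2 + t) (u ++ s ∷ ss))
                   (cong ((2 + t) *_) (length-++ u))) ⟩
  length (fixingWord u ss) + suc ((2 + t) * (p + suc t))
    ≤⟨ +-monoˡ-≤ _ (length-fixingWord u ss) ⟩
  p + t * (1 + (1 + t) * (p + t)) + suc ((2 + t) * (p + suc t))
    ≤⟨ +-monoˡ-≤ _ (+-monoʳ-≤ p (*-monoʳ-≤ t (s≤s
         (*-mono-≤ (n≤1+n (1 + t)) (+-monoʳ-≤ p (n≤1+n t)))))) ⟩
  p + t * (1 + (2 + t) * (p + suc t)) + suc ((2 + t) * (p + suc t))
    ≡⟨ collect p t ((2 + t) * (p + suc t)) ⟩
  p + suc t * (1 + (2 + t) * (p + suc t)) ∎
  where
  open ≤-Reasoning
  p = length u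
  t = length ss
  rounds = concat (replicate (2 + t) (u ++ s ∷ ss))
  collect : ∀ p t c → p + t * (1 + c) + suc c ≡ p + suc t * (1 + c)
  collect = solve-∀

-- With `M = 1 ⊔ t`, both `1` and `t` are at most `M`, so `1 + t` is at most `2M` and the product at
-- most `4M²n`. The terms `p` and `t` add at most `2n`, hence the constant 6.
length-bound : ∀ {n p t} → p ≤ n → t ≤ n →
               p + t * (1 + (1 + t) * (p + t)) ≤ 6 * order t n
length-bound {n} {p} {t} p≤n t≤n = begin
  p + t * (1 + (1 + t) * (p + t))
    ≡⟨ cong (p +_) (*-distribˡ-+ t 1 _) ⟩
  p + (t * 1 + t * ((1 + t) * (p + t)))
    ≤⟨ +-mono-≤ p≤n (+-mono-≤ (≤-trans (≤-reflexive (*-identityʳ t)) t≤n)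
         (*-mono-≤ t≤M (*-mono-≤ (+-mono-≤ 1≤M t≤M) (+-mono-≤ p≤n t≤n)))) ⟩
  n + (n + M * ((M + M) * (n + n)))
    ≡⟨ collect M n ⟩
  2 * n + 4 * (M ^ 2 * n)
    ≤⟨ +-monoˡ-≤ _ (*-monoʳ-≤ 2 n≤M²n) ⟩
  2 * (M ^ 2 * n) + 4 * (M ^ 2 * n)
    ≡⟨ *-distribʳ-+ (M ^ 2 * n) 2 4 ⟨
  6 * (M ^ 2 * n) ∎
  where
  open ≤-Reasoning
  M = 1 ⊔ t
  1≤M : 1 ≤ M
  1≤M = m≤m⊔n 1 t
  t≤M : t ≤ M
  t≤M = m≤n⊔m 1 t
  n≤M²n : n ≤ M ^ 2 * n
  n≤M²n = ≤-trans (≤-reflexive (sym (*-identityˡ n)))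
                  (*-monoˡ-≤ n (*-mono-≤ 1≤M (*-mono-≤ 1≤M ≤-refl)))
  collect : ∀ M n → n + (n + M * ((M + M) * (n + n))) ≡ 2 * n + 4 * (M * (M * 1) * n)
  collect = solve-∀

-- Asynchronous dynamics

module _ (f : Network n) where

  Stable : List (Fin n) → State n → Set
  Stable T x = ∀ {i} → i ∈ T → lookup (f x) i ≡ lookup x i

  run-++ : ∀ v w x → run f (v ++ w) x ≡ run f w (run f v x)
  run-++ []      w x = refl
  run-++ (i ∷ v) w x = run-++ v w (update f i x)

  run-∉ : ∀ w x {i} → ¬ i ∈ w → lookup (run f w x) i ≡ lookup x i
  run-∉ []      x i∉w = refl
  run-∉ (j ∷ w) x i∉w =
    trans (run-∉ w _ (i∉w ∘ there)) (lookup∘update′ (i∉w ∘ here) x _)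

  run-stable : ∀ {T} w {x} → w ⊆ T → Stable T x → run f w x ≡ x
  run-stable []      w⊆T stable = refl
  run-stable (i ∷ w) {x} w⊆T stable =
    trans (cong (run f w) update-id) (run-stable w (w⊆T ∘ there) stable)
    where
    update-id : update f i x ≡ x
    update-id =
      trans (cong (x [ i ]≔_) (stable (w⊆T (here refl)))) ([]≔-lookup x i)

  concat-replicate⊆ : ∀ m (T : List (Fin n)) → concat (replicate m T) ⊆ T
  concat-replicate⊆ (suc m) T = [ id , concat-replicate⊆ m T ]′ ∘ ∈-++⁻ T

  stable⇒fixed : ∀ {T x} → (∀ i → i ∈ T) → Stable T x → f x ≡ x
  stable⇒fixed total stable =
    Pointwise-≡⇒≡ (extensional⇒inductive (ext λ i → stable (total i)))

  -- If `b` is the old value, the state is the same; otherwise the two states differ only at `j` and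
  -- would witness a dependency.
  independent-update : ∀ {i j} → ¬ DependsOn f i j → ∀ x b →
                       lookup (f (x [ j ]≔ b)) i ≡ lookup (f x) i
  independent-update {i} {j} ¬dep x b
    with lookup x j Bool.≟ b | lookup (f (x [ j ]≔ b)) i Bool.≟ lookup (f x) i
  ... | yes refl | _      = cong (λ y → lookup (f y) i) ([]≔-lookup x j)
  ... | no  _    | yes eq = eq
  ... | no  xⱼ≢b | no neq = contradiction (x , x [ j ]≔ b , differ , neq ∘ sym) ¬dep
    where
    differ : DifferOnlyAt j x (x [ j ]≔ b)
    differ = (λ eq → xⱼ≢b (trans eq (lookup∘update j x b))) ,
             λ k k≢j → sym (lookup∘update′ k≢j x b)

  independent-run : ∀ {i} w → All (λ j → ¬ DependsOn f i j) w → ∀ x →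
                    lookup (f (run f w x)) i ≡ lookup (f x) i
  independent-run []      []             x = refl
  independent-run (j ∷ w) (¬dep ∷ ¬deps) x =
    trans (independent-run w ¬deps (update f j x)) (independent-update ¬dep x _)

  -- `f` at `i` reads neither `i` nor any later component of `u`, so the value given to `i` at its
  -- turn remains correct until the end.
  topological-run-stable : ∀ {u} → AllPairs (λ i j → ¬ DependsOn f i j) u →
    All (λ i → ¬ DependsOn f i i) u → ∀ x → Stable u (run f u x)
  topological-run-stable {i ∷ w} (¬deps ∷ sorted) (¬loop ∷ ¬loops) x = λ where
      (there j∈w) → tail-stable j∈w
      (here refl) → head-stable
    where
    x′ = update f i x
    tail-stable : Stable w (run f w x′)
    tail-stable = topological-run-stable sorted ¬loops x′
    head-stable : lookup (f (run f w x′)) i ≡ lookup (run f w x′) i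
    head-stable with member? _≟ᶠ_ i w
    -- A repeated component is settled by its later occurrence.
    ... | yes i∈w = tail-stable i∈w
    ... | no  i∉w = begin
      lookup (f (run f w x′)) i ≡⟨ independent-run w ¬deps x′ ⟩
      lookup (f x′) i           ≡⟨ independent-update ¬loop x _ ⟩
      lookup (f x) i            ≡⟨ lookup∘update i x _ ⟨
      lookup x′ i               ≡⟨ run-∉ w x′ i∉w ⟨
      lookup (run f w x′) i     ∎
      where open ≡-Reasoning

-- Monotone networks moving in one direction

-- x ⊴[ true ] y is x ≤ y and x ⊴[ false ] y is y ≤ x.

infix 4 _⊴[_]_

_⊴[_]_ : State n → Bool → State n → Set
x ⊴[ b ] y = ∀ i → lookup x i ≡ b → lookup y i ≡ b

module _ (f : Network n) (mono : Monotone f) where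

  -- Monotonicity is self-dual, so everything below can treat both directions at once.
  monotone-⊴ : ∀ b {x y} → x ⊴[ b ] y → f x ⊴[ b ] f y
  monotone-⊴ true x⊴y i =
    ≤ᵇ-true (app (mono (extensional⇒inductive (ext λ j → to-≤ᵇ (x⊴y j)))) i)
    where
    to-≤ᵇ : ∀ {a b} → (a ≡ true → b ≡ true) → a ≤ᵇ b
    to-≤ᵇ {false} {false} _ = b≤b
    to-≤ᵇ {false} {true}  _ = f≤t
    to-≤ᵇ {true}          h rewrite h refl = b≤b
    ≤ᵇ-true : ∀ {a b} → a ≤ᵇ b → a ≡ true → b ≡ true
    ≤ᵇ-true b≤b eq = eq
  monotone-⊴ false x⊴y i =
    ≤ᵇ-false (app (mono (extensional⇒inductive (ext λ j → to-≤ᵇ (x⊴y j)))) i)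
    where
    to-≤ᵇ : ∀ {a b} → (a ≡ false → b ≡ false) → b ≤ᵇ a
    to-≤ᵇ {true}  {false} _ = f≤t
    to-≤ᵇ {true}  {true}  _ = b≤b
    to-≤ᵇ {false}         h rewrite h refl = b≤b
    ≤ᵇ-false : ∀ {a b} → b ≤ᵇ a → a ≡ false → b ≡ false
    ≤ᵇ-false b≤b eq = eq

  module _ (b : Bool) where

    -- On `T` this is `x ≤ f x` for `b = true` and `f x ≤ x` for `b = false`: updates in `T` can
    -- only move towards `b`.
    Advancing : List (Fin n) → State n → Set
    Advancing T x = ∀ {i} → i ∈ T → lookup x i ≡ b → lookup (f x) i ≡ b

    module _ {T : List (Fin n)} where

      update-⊴ : ∀ {x i} → Advancing T x → i ∈ T → x ⊴[ b ] update f i x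
      update-⊴ {x} {i} adv i∈T j xⱼ≡b with j ≟ᶠ i
      ... | yes refl = trans (lookup∘update i x _) (adv i∈T xⱼ≡b)
      ... | no  j≢i  = trans (lookup∘update′ j≢i x _) xⱼ≡b

      -- A component equal to `b` after the update already had image `b` under `f` before it, and
      -- monotonicity preserves this image as the state moves towards `b`.
      update-advancing : ∀ {x i} → Advancing T x → i ∈ T → Advancing T (update f i x)
      update-advancing {x} {i} adv i∈T {j} j∈T xⱼ′≡b =
        monotone-⊴ b (update-⊴ adv i∈T) j fⱼx≡b
        where
        fⱼx≡b : lookup (f x) j ≡ b
        fⱼx≡b with j ≟ᶠ i
        ... | yes refl = trans (sym (lookup∘update i x _)) xⱼ′≡b
        ... | no  j≢i  = adv j∈T (trans (sym (lookup∘update′ j≢i x _)) xⱼ′≡b)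

      run-⊴ : ∀ w {x} → w ⊆ T → Advancing T x → x ⊴[ b ] run f w x
      run-⊴ []      w⊆T adv j = id
      run-⊴ (i ∷ w) w⊆T adv j =
        run-⊴ w (w⊆T ∘ there) (update-advancing adv (w⊆T (here refl))) j ∘
        update-⊴ adv (w⊆T (here refl)) j

      run-advancing : ∀ w {x} → w ⊆ T → Advancing T x → Advancing T (run f w x)
      run-advancing []      w⊆T adv = adv
      run-advancing (i ∷ w) w⊆T adv =
        run-advancing w (w⊆T ∘ there) (update-advancing adv (w⊆T (here refl)))

      -- The image `b` at `i` survives until `i` is updated; from then on `i` itself keeps the value
      -- `b`.
      run-reaches : ∀ {w x i} → w ⊆ T → Advancing T x → i ∈ w →
                    lookup (f x) i ≡ b → lookup (run f w x) i ≡ b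
      run-reaches {i ∷ w} {x} w⊆T adv (here refl) fᵢx≡b =
        run-⊴ w (w⊆T ∘ there) (update-advancing adv (w⊆T (here refl))) i
          (trans (lookup∘update i x _) fᵢx≡b)
      run-reaches {j ∷ w} {i = i} w⊆T adv (there i∈w) fᵢx≡b =
        run-reaches (w⊆T ∘ there) (update-advancing adv (w⊆T (here refl))) i∈w
          (monotone-⊴ b (update-⊴ adv (w⊆T (here refl))) i fᵢx≡b)

    module _ {u ss : List (Fin n)} (u-stable : ∀ x → Stable f u (run f u x)) where

      -- rs contains the components of ss that have not changed to b yet.
      rounds-stable : ∀ m rs {x} → length rs < m → Advancing (u ++ ss) x →
        (∀ {i} → i ∈ ss → lookup x i ≢ b → i ∈ rs) →
        Stable f (u ++ ss) (run f (concat (replicate m (u ++ ss))) x)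
      rounds-stable (suc m) rs {x} rs<m adv remaining =
        subst (Stable f (u ++ ss)) (sym split) last-rounds
        where
        T = u ++ ss
        y = run f u x
        z = run f ss y
        rest = concat (replicate m T)
        u⊆T : u ⊆ T
        u⊆T = ∈-++⁺ˡ
        ss⊆T : ss ⊆ T
        ss⊆T = ∈-++⁺ʳ u
        split : run f (T ++ rest) x ≡ run f rest z
        split = trans (run-++ f T rest x) (cong (run f rest) (run-++ f u ss x))
        y-advancing : Advancing T y
        y-advancing = run-advancing u u⊆T adv
        opposite : ∀ {a c} → a ≢ b → c ≢ a → c ≡ b
        opposite a≢b c≢a = trans (Bool.¬-not c≢a) (sym (Bool.¬-not (a≢b ∘ sym)))
        last-rounds : Stable f T (run f rest z)
        -- After `u`, only components in `ss` can be unstable. If none is, the remaining letters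
        -- change nothing.
        last-rounds with any? (λ i → ¬? (lookup (f y) i Bool.≟ lookup y i)) ss
        ... | no all-stable =
          subst (Stable f T)
            (sym (trans (cong (run f rest) (run-stable f ss ss⊆T y-stable))
                        (run-stable f rest (concat-replicate⊆ f m T) y-stable)))
            y-stable
          where
          y-stable : Stable f T y
          y-stable {i} i∈T with ∈-++⁻ u i∈T | lookup (f y) i Bool.≟ lookup y i
          ... | _         | yes eq = eq
          ... | inj₁ i∈u  | no _   = u-stable x i∈u
          ... | inj₂ i∈ss | no neq = contradiction (lose i∈ss neq) all-stable
        -- In an advancing state an unstable component is not at `b`, so its image is `b` and
        -- running `ss` brings it there. It was not at `b` in `x` either, so it is in `rs` and can
        -- be erased.
        ... | yes some-unstable
          with i , i∈ss , fᵢy≢yᵢ ← find some-unstable =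
          rounds-stable m (erase i rs)
            (<-≤-trans (length-erase (remaining i∈ss xᵢ≢b)) (s≤s⁻¹ rs<m))
            (run-advancing ss ss⊆T y-advancing)
            (λ {j} j∈ss zⱼ≢b → ∈-erase⁺
              (remaining j∈ss (zⱼ≢b ∘ run-⊴ ss ss⊆T y-advancing j ∘ run-⊴ u u⊆T adv j))
              (λ { refl → zⱼ≢b zᵢ≡b }))
          where
          yᵢ≢b : lookup y i ≢ b
          yᵢ≢b yᵢ≡b = fᵢy≢yᵢ (trans (y-advancing (ss⊆T i∈ss) yᵢ≡b) (sym yᵢ≡b))
          xᵢ≢b : lookup x i ≢ b
          xᵢ≢b = yᵢ≢b ∘ run-⊴ u u⊆T adv i
          zᵢ≡b : lookup z i ≡ b
          zᵢ≡b = run-reaches ss⊆T y-advancing i∈ss (opposite yᵢ≢b fᵢy≢yᵢ)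

  -- Since `b` is the image at `s`, the update moves `x` towards `b`. Every component of `T′` at `b`
  -- afterwards had image `b` in `x`, by stability or because it is `s`; monotonicity carries this
  -- over.
  stable⇒update-advancing : ∀ {T x} s → Stable f T x →
    ∀ {T′} → (∀ {i} → i ∈ T′ → i ≢ s → i ∈ T) →
    Advancing (lookup (f x) s) T′ (update f s x)
  stable⇒update-advancing {T} {x} s stable T′⊆ {i} i∈T′ xᵢ′≡b =
    monotone-⊴ b x⊴x′ i fᵢx≡b
    where
    b = lookup (f x) s
    x⊴x′ : x ⊴[ b ] update f s x
    x⊴x′ j xⱼ≡b with j ≟ᶠ s
    ... | yes refl = lookup∘update s x b
    ... | no  j≢s  = trans (lookup∘update′ j≢s x b) xⱼ≡b
    fᵢx≡b : lookup (f x) i ≡ b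
    fᵢx≡b with i ≟ᶠ s
    ... | yes refl = refl
    ... | no  i≢s  =
      trans (stable (T′⊆ i∈T′ i≢s)) (trans (sym (lookup∘update′ i≢s x b)) xᵢ′≡b)

  fixingWord-stable : ∀ {u} → (∀ x → Stable f u (run f u x)) →
    ∀ ss x → Stable f (u ++ ss) (run f (fixingWord u ss) x)
  fixingWord-stable {u} u-stable [] x = [ u-stable x , (λ ()) ]′ ∘ ∈-++⁻ u
  fixingWord-stable {u} u-stable (s ∷ ss) x =
    subst (Stable f (u ++ s ∷ ss)) (sym (run-++ f (fixingWord u ss) _ x))
      -- Initially every element of `s ∷ ss` counts as unchanged; its length is just below the
      -- number of rounds.
      (rounds-stable (lookup (f y) s) u-stable (2 + length ss) (s ∷ ss) ≤-refl
        (stable⇒update-advancing s (fixingWord-stable u-stable ss x) skip)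
        (λ i∈ _ → i∈))
    where
    y = run f (fixingWord u ss) x
    skip : ∀ {i} → i ∈ u ++ s ∷ ss → i ≢ s → i ∈ u ++ ss
    skip i∈ i≢s with ∈-++⁻ u i∈
    ... | inj₁ i∈u          = ∈-++⁺ˡ i∈u
    ... | inj₂ (here i≡s)   = contradiction i≡s i≢s
    ... | inj₂ (there i∈ss) = ∈-++⁺ʳ u i∈ss

-- Fixing all monotone networks placed in a graph

theorem5 : ∃[ C ]
    ((n τ : ℕ) (G : Digraph n) → IsTransversalNumber G τ →
    ∃[ w ]
    length w ≤ C * order τ n ×
    ((f : Network n) → Monotone f →
    (K : Digraph n) → K ⊑ G →
    (π : Permutation′ n) → IsIsomorphism (interactionGraph f) K π →
    Fixes (pullback π w) f))
theorem5 = 6 , λ { n _ G ((S , refl , acyclic) , _) → construction n G S acyclic }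
  where
  construction : ∀ n (G : Digraph n) (S : Subset n) → Acyclic (G ∖ S) →
    ∃[ w ]
    length w ≤ 6 * order ∣ S ∣ n ×
    ((f : Network n) → Monotone f →
    (K : Digraph n) → K ⊑ G →
    (π : Permutation′ n) → IsIsomorphism (interactionGraph f) K π →
    Fixes (pullback π w) f)
  construction n G S acyclic = fixingWord u ss , short , fixes
    where
    ss = elements S
    R = filter (λ i → ¬? (i ∈ˢ? S)) (allFin n)
    sort = topological-sort (G ∖ S) acyclic (length R) R ≤-refl
    u = proj₁ sort
    u-sorted = proj₁ (proj₂ sort)
    u⊆R = proj₁ (proj₂ (proj₂ sort))
    R⊆u = proj₁ (proj₂ (proj₂ (proj₂ sort)))
    u≤R = proj₂ (proj₂ (proj₂ (proj₂ sort)))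

    u≤n : length u ≤ n
    u≤n = ≤-trans u≤R (≤-trans (length-filter _ (allFin n))
                               (≤-reflexive (length-tabulate id)))

    short : length (fixingWord u ss) ≤ 6 * order ∣ S ∣ n
    short = subst (λ t → length (fixingWord u ss) ≤ 6 * order t n) (length-elements S)
      (≤-trans (length-fixingWord u ss)
        (length-bound u≤n (≤-trans (≤-reflexive (length-elements S)) (∣p∣≤n S))))

    u∉S : All (_∉ S) u
    u∉S = All.tabulate λ i∈u → proj₂ (∈-filter⁻ _ {xs = allFin n} (u⊆R i∈u))

    -- Between vertices outside `S`, the graphs `G` and `G ∖ S` have the same edges.
    no-backward-edge : ∀ {v} → All (_∉ S) v →
      AllPairs (λ i j → ¬ Edge (G ∖ S) j i) v → AllPairs (λ i j → ¬ Edge G j i) v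
    no-backward-edge []           []              = []
    no-backward-edge (i∉S ∷ v∉S) (¬es ∷ sorted) =
      All.zipWith (λ { (j∉S , ¬e) e → ¬e (j∉S , i∉S , e) }) (v∉S , ¬es) ∷
      no-backward-edge v∉S sorted

    no-loop : All (λ i → ¬ Edge G i i) u
    no-loop = All.map (λ {i} i∉S e → acyclic i [] ([] ∷ [] , (i∉S , i∉S , e) ∷ [-])) u∉S

    covers : ∀ i → i ∈ u ++ ss
    covers i with i ∈ˢ? S
    ... | yes i∈S = ∈-++⁺ʳ u (∈-elements S i∈S)
    ... | no  i∉S = ∈-++⁺ˡ (R⊆u (∈-filter⁺ _ (∈-allFin i) i∉S))

    fixes : (f : Network n) → Monotone f → (K : Digraph n) → K ⊑ G →
      (π : Permutation′ n) → IsIsomorphism (interactionGraph f) K π →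
      Fixes (pullback π (fixingWord u ss)) f
    fixes f mono K K⊑G π iso x =
      subst (λ w → f (run f w x) ≡ run f w x) (sym (map-fixingWord g u ss))
        (stable⇒fixed f covers′ (fixingWord-stable f mono u′-stable (map g ss) x))
      where
      g = π ⟨$⟩ˡ_

      -- The isomorphism sends a dependency of `g i` on `g j` to an edge of `K` from `j` to `i`, as
      -- `π` undoes `g`; this is an edge of `G`.
      ¬edge⇒¬dependsOn : ∀ {i j} → ¬ Edge G j i → ¬ DependsOn f (g i) (g j)
      ¬edge⇒¬dependsOn ¬e dep =
        ¬e (subst₂ (Edge G) (inverseʳ π) (inverseʳ π)
              (K⊑G _ _ (Equivalence.to (iso _ _) dep)))

      u′-stable : ∀ y → Stable f (map g u) (run f (map g u) y)
      u′-stable = topological-run-stable f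
        (AllPairs.map⁺ (AllPairs.map ¬edge⇒¬dependsOn (no-backward-edge u∉S u-sorted)))
        (All.map⁺ (All.map ¬edge⇒¬dependsOn no-loop))

      covers′ : ∀ i → i ∈ map g u ++ map g ss
      covers′ i = subst₂ _∈_ (inverseˡ π) (map-++ g u ss) (∈-map⁺ g (covers (π ⟨$⟩ʳ i)))
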